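{- There is a function $\varepsilon:\mathbb{N}\to\mathbb{R}$ with $\varepsilon(n)/n\to0$ as $n\to\infty$ such that for all positive integers $n$ and $k$ with $\sqrt n\le k\le n$, $$d(k,n)\le 2k\sqrt n-n+\varepsilon(n).$$
   Context: Write $[n]=\{1,\dots,n\}$ and $A-A=\{a-b:a,b\in A\}$. Define $d(k,n)=\max\{|A-A| : A\subseteq[n],\ |A|=k\}$. -}

module Defs where

open import Data.Nat using (ℕ; zero; suc; _⊔_)
open import Data.Nat.Properties using (_≟_)
open import Data.Bool using (true; false)
open import Data.Fin using (Fin; toℕ) renaming (zero to fzero; suc to fsuc)
open import Data.Fin.Subset using (Subset; ∣_∣; inside; outside)
open import Data.Vec using (_∷_; [])
open import Data.List using (List; []; _∷_; map; concatMap; length; filter; foldr; _++_; deduplicate)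
open import Data.Integer as ℤ using (ℤ; +_)

-- Elements of a subset of Fin n. Fin n = {0,…,n-1} models [n] = {1,…,n} via i ↦ i+1
-- (a shift, which does not affect the difference set).
members : ∀ {n} → Subset n → List (Fin n)
members []            = []
members (false ∷ p)   = map fsuc (members p)
members (true ∷ p)    = fzero ∷ map fsuc (members p)

allSubsets : ∀ n → List (Subset n)
allSubsets zero    = [] ∷ []
allSubsets (suc n) = map (outside ∷_) (allSubsets n) ++ map (inside ∷_) (allSubsets n)

diffSet : ∀ {n} → Subset n → List ℤ
diffSet A = deduplicate ℤ._≟_
  (concatMap (λ a → map (λ b → (+ toℕ a) ℤ.- (+ toℕ b)) (members A)) (members A))

diffCard : ∀ {n} → Subset n → ℕ
diffCard A = length (diffSet A)

-- d(k,n) = max { |A - A| : A ⊆ [n], |A| = k }  (0 if no such A, i.e. k > n)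
d : ℕ → ℕ → ℕ
d k n = foldr _⊔_ 0 (map diffCard (filter (λ A → ∣ A ∣ ≟ k) (allSubsets n)))

{-# OPTIONS --safe #-}
-- Fix an interval I of length u and let W(z) ≤ u be the number of i, j ∈ I with z = j − i.
-- Summing W + (u − W) over the distinct differences z of A gives, with k = |A|,
--   u |A−A| ≤ u² + Σ_{a,b∈A} (u − W(a−b)) = u² + u k² − Σ_{a,b∈A} W(a−b),
-- and Σ W(a−b) is at least the number of solutions of a + i = b + j, hence at least
-- (ku)² / (n+u) by Cauchy–Schwarz, since A + I lies in an interval of length n + u.
-- So v (|A−A| + n) ≤ k² n + v² with v = n + u; taking v = ⌊k√n⌋ + 1 shows that the
-- constant error term ε = 1 suffices.
module Submission where

open import Defs
open import Data.Nat as ℕ using (ℕ; _≤_)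
open import Data.Integer using (+_)
open import Data.Product using (Σ; _×_)
open import Data.Sum using (_⊎_)
open import Data.Rational using (ℚ; _+_; _-_; _*_; _<_; ∣_∣; 0ℚ; Positive)
open import Data.Rational as Q using ()
open import Data.Bool using (if_then_else_; true; false)
open import Data.Fin using (Fin; toℕ)
open import Data.Fin.Properties using (toℕ<n; toℕ-injective)
open import Data.Fin.Subset as Sub using (Subset)
import Data.Integer as ℤ
import Data.Integer.Properties as ℤₚ
open import Algebra.Bundles using (AbelianGroup)
open import Algebra.Properties.Group (AbelianGroup.group ℤₚ.+-0-abelianGroup) using (∙-cancelʳ)
import Data.Integer.Tactic.RingSolver as ℤ-Solver
open import Data.List using (List; []; _∷_; allFin; length; map; concatMap; filter; deduplicate; upTo)
open import Data.List.Membership.Propositional using (_∈_)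
open import Data.List.Membership.Propositional.Properties using (∈-upTo⁺)
open import Data.List.Properties using (foldr-preservesᵇ; length-map; length-tabulate; length-upTo; map-++; map-∘)
open import Data.List.Relation.Unary.All as All using (All; []; _∷_)
open import Data.List.Relation.Unary.All.Properties using (map⁺; all-filter)
open import Data.List.Relation.Unary.AllPairs using (_∷_)
open import Data.List.Relation.Unary.Any using (here; there)
open import Data.List.Relation.Unary.Unique.DecPropositional.Properties using (deduplicate-!)
open import Data.List.Relation.Unary.Unique.Propositional using (Unique)
open import Data.List.Relation.Unary.Unique.Propositional.Properties using (allFin⁺; upTo⁺)
open import Data.Nat using (z≤n; s≤s; s≤s⁻¹; >-nonZero; NonZero; suc; zero; _∸_; _≟_)
open import Data.Nat.ListAction using (sum)
open import Data.Nat.ListAction.Properties using (sum-++)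
open import Data.Nat.Properties hiding (_≟_)
open import Data.Nat.Tactic.RingSolver using (solve-∀)
open import Data.Product using (_,_; ∃)
import Data.Rational.Properties as Qₚ
open import Data.Rational.Unnormalised as ℚᵘ using (mkℚᵘ; *<*; *≤*; *≡*)
import Data.Rational.Unnormalised.Properties as ℚᵘₚ
open import Data.Sum using (inj₁; inj₂)
open import Data.Vec using (_∷_; [])
open import Function using (_∘_; id)
open import Level using (Level)
open import Relation.Binary using (DecidableEquality)
open import Relation.Binary.PropositionalEquality
open import Relation.Nullary using (¬_; Dec; yes; no; does; ¬?; contradiction)
open import Relation.Unary using (Pred; Decidable)

private
  variable
    p : Level
    X Y Z : Set

-- Finite sums over lists.

∑ : List X → (X → ℕ) → ℕ
∑ xs f = sum (map f xs)

infixl 10 ∑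
syntax ∑ xs (λ x → e) = ∑[ x ∈ xs ] e

∑-mono : (xs : List X) {f g : X → ℕ} → (∀ x → f x ≤ g x) → ∑ xs f ≤ ∑ xs g
∑-mono []       f≤g = z≤n
∑-mono (x ∷ xs) f≤g = +-mono-≤ (f≤g x) (∑-mono xs f≤g)

∑-cong : (xs : List X) {f g : X → ℕ} → (∀ x → f x ≡ g x) → ∑ xs f ≡ ∑ xs g
∑-cong []       f≡g = refl
∑-cong (x ∷ xs) f≡g = cong₂ ℕ._+_ (f≡g x) (∑-cong xs f≡g)

∑-const : (xs : List X) (c : ℕ) → ∑[ x ∈ xs ] c ≡ length xs ℕ.* c
∑-const []       c = refl
∑-const (x ∷ xs) c = cong (c ℕ.+_) (∑-const xs c)

∑-≤-const : (xs : List X) {f : X → ℕ} {c : ℕ} → (∀ x → f x ≤ c) → ∑ xs f ≤ length xs ℕ.* c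
∑-≤-const xs {c = c} f≤c = ≤-trans (∑-mono xs f≤c) (≤-reflexive (∑-const xs c))

∑-+ : (xs : List X) (f g : X → ℕ) → ∑[ x ∈ xs ] (f x ℕ.+ g x) ≡ ∑ xs f ℕ.+ ∑ xs g
∑-+ []       f g = refl
∑-+ (x ∷ xs) f g rewrite ∑-+ xs f g = interchange (f x) (g x) (∑ xs f) (∑ xs g)
  where
  interchange : ∀ m n o q → m ℕ.+ n ℕ.+ (o ℕ.+ q) ≡ m ℕ.+ o ℕ.+ (n ℕ.+ q)
  interchange = solve-∀

*-∑ : (xs : List X) (c : ℕ) (f : X → ℕ) → c ℕ.* ∑ xs f ≡ ∑[ x ∈ xs ] (c ℕ.* f x)
*-∑ []       c f = *-zeroʳ c
*-∑ (x ∷ xs) c f rewrite *-distribˡ-+ c (f x) (∑ xs f) = cong (c ℕ.* f x ℕ.+_) (*-∑ xs c f)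

∑-swap : (xs : List X) (ys : List Y) (f : X → Y → ℕ) →
         ∑[ x ∈ xs ] ∑[ y ∈ ys ] f x y ≡ ∑[ y ∈ ys ] ∑[ x ∈ xs ] f x y
∑-swap []       ys f = sym (trans (∑-const ys 0) (*-zeroʳ (length ys)))
∑-swap (x ∷ xs) ys f = trans
  (cong (∑ ys (f x) ℕ.+_) (∑-swap xs ys f))
  (sym (∑-+ ys (f x) (λ y → ∑[ x′ ∈ xs ] f x′ y)))

∑-*-∑ : (xs : List X) (ys : List Y) (f : X → ℕ) (g : Y → ℕ) →
        ∑ xs f ℕ.* ∑ ys g ≡ ∑[ x ∈ xs ] ∑[ y ∈ ys ] (f x ℕ.* g y)
∑-*-∑ xs ys f g = begin
  ∑ xs f ℕ.* ∑ ys g               ≡⟨ *-comm (∑ xs f) (∑ ys g) ⟩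
  ∑ ys g ℕ.* ∑ xs f               ≡⟨ *-∑ xs (∑ ys g) f ⟩
  ∑[ x ∈ xs ] (∑ ys g ℕ.* f x)    ≡⟨ ∑-cong xs (λ x → trans (*-comm (∑ ys g) (f x)) (*-∑ ys (f x) g)) ⟩
  ∑[ x ∈ xs ] ∑[ y ∈ ys ] (f x ℕ.* g y) ∎
  where open ≡-Reasoning

∑-concatMap-map : (g : X → Y → Z) (xs : List X) (ys : List Y) (f : Z → ℕ) →
                  ∑ (concatMap (λ x → map (g x) ys) xs) f ≡ ∑[ x ∈ xs ] ∑[ y ∈ ys ] f (g x y)
∑-concatMap-map g []       ys f = refl
∑-concatMap-map g (x ∷ xs) ys f
  rewrite map-++ f (map (g x) ys) (concatMap (λ x′ → map (g x′) ys) xs)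
        | sum-++ (map f (map (g x) ys)) (map f (concatMap (λ x′ → map (g x′) ys) xs))
  = cong₂ ℕ._+_ (cong sum (sym (map-∘ ys))) (∑-concatMap-map g xs ys f)

∑-filter-≤ : {P : Pred X p} (P? : Decidable P) (xs : List X) (f : X → ℕ) → ∑ (filter P? xs) f ≤ ∑ xs f
∑-filter-≤ P? []       f = z≤n
∑-filter-≤ P? (x ∷ xs) f with does (P? x)
... | true  = +-monoʳ-≤ (f x) (∑-filter-≤ P? xs f)
... | false = ≤-trans (∑-filter-≤ P? xs f) (m≤n+m _ (f x))

∑-deduplicate-≤ : (_≟ˣ_ : DecidableEquality X) (xs : List X) (f : X → ℕ) →
                  ∑ (deduplicate _≟ˣ_ xs) f ≤ ∑ xs f
∑-deduplicate-≤ _≟ˣ_ []       f = z≤n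
∑-deduplicate-≤ _≟ˣ_ (x ∷ xs) f = +-monoʳ-≤ (f x)
  (≤-trans (∑-filter-≤ (¬? ∘ (x ≟ˣ_)) (deduplicate _≟ˣ_ xs) f) (∑-deduplicate-≤ _≟ˣ_ xs f))

-- The Cauchy-Schwarz inequality over ℕ.

2mn≤m²+n² : ∀ m n → 2 ℕ.* (m ℕ.* n) ≤ m ℕ.* m ℕ.+ n ℕ.* n
2mn≤m²+n² m n with ≤-total m n
... | inj₁ m≤n rewrite sym (m+[n∸m]≡n m≤n) = ordered m (n ∸ m)
  where
  identity : ∀ m t → m ℕ.* m ℕ.+ (m ℕ.+ t) ℕ.* (m ℕ.+ t) ≡ 2 ℕ.* (m ℕ.* (m ℕ.+ t)) ℕ.+ t ℕ.* t
  identity = solve-∀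
  ordered : ∀ m t → 2 ℕ.* (m ℕ.* (m ℕ.+ t)) ≤ m ℕ.* m ℕ.+ (m ℕ.+ t) ℕ.* (m ℕ.+ t)
  ordered m t = ≤-trans (m≤m+n _ (t ℕ.* t)) (≤-reflexive (sym (identity m t)))
... | inj₂ n≤m rewrite sym (m+[n∸m]≡n n≤m) = ordered n (m ∸ n)
  where
  identity : ∀ n t → (n ℕ.+ t) ℕ.* (n ℕ.+ t) ℕ.+ n ℕ.* n ≡ 2 ℕ.* ((n ℕ.+ t) ℕ.* n) ℕ.+ t ℕ.* t
  identity = solve-∀
  ordered : ∀ n t → 2 ℕ.* ((n ℕ.+ t) ℕ.* n) ≤ (n ℕ.+ t) ℕ.* (n ℕ.+ t) ℕ.+ n ℕ.* n
  ordered n t = ≤-trans (m≤m+n _ (t ℕ.* t)) (≤-reflexive (sym (identity n t)))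

-- The square of the sum expands into the products `f x * f y` over all pairs, and each pair obeys
-- `2mn≤m²+n²`. Everything is doubled first and the factor 2 cancelled last, so that no halves
-- occur.
cauchy-schwarz : (xs : List X) (f : X → ℕ) →
                 ∑ xs f ℕ.* ∑ xs f ≤ length xs ℕ.* (∑[ x ∈ xs ] (f x ℕ.* f x))
cauchy-schwarz xs f = *-cancelˡ-≤ 2 (begin
  2 ℕ.* (∑ xs f ℕ.* ∑ xs f)
    ≡⟨ cong (2 ℕ.*_) (∑-*-∑ xs xs f f) ⟩
  2 ℕ.* (∑[ x ∈ xs ] ∑[ y ∈ xs ] (f x ℕ.* f y))
    ≡⟨ *-∑ xs 2 _ ⟩
  ∑[ x ∈ xs ] (2 ℕ.* (∑[ y ∈ xs ] (f x ℕ.* f y)))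
    ≡⟨ ∑-cong xs (λ x → *-∑ xs 2 _) ⟩
  ∑[ x ∈ xs ] ∑[ y ∈ xs ] (2 ℕ.* (f x ℕ.* f y))
    ≤⟨ ∑-mono xs (λ x → ∑-mono xs (λ y → 2mn≤m²+n² (f x) (f y))) ⟩
  ∑[ x ∈ xs ] ∑[ y ∈ xs ] (f x ℕ.* f x ℕ.+ f y ℕ.* f y)
    ≡⟨ ∑-cong xs (λ x → trans (∑-+ xs _ _) (cong (ℕ._+ S) (∑-const xs (f x ℕ.* f x)))) ⟩
  ∑[ x ∈ xs ] (length xs ℕ.* (f x ℕ.* f x) ℕ.+ S)
    ≡⟨ ∑-+ xs _ _ ⟩
  (∑[ x ∈ xs ] (length xs ℕ.* (f x ℕ.* f x))) ℕ.+ (∑[ x ∈ xs ] S)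
    ≡⟨ cong₂ ℕ._+_ (sym (*-∑ xs (length xs) _)) (∑-const xs S) ⟩
  length xs ℕ.* S ℕ.+ length xs ℕ.* S
    ≡⟨ cong (length xs ℕ.* S ℕ.+_) (sym (+-identityʳ _)) ⟩
  2 ℕ.* (length xs ℕ.* S) ∎)
  where
  open ≤-Reasoning
  S = ∑[ x ∈ xs ] (f x ℕ.* f x)

-- Indicators and counting solutions.

𝟙 : {P : Set p} → Dec P → ℕ
𝟙 P? = if does P? then 1 else 0

𝟙-yes : {P : Set p} (P? : Dec P) → P → 𝟙 P? ≡ 1
𝟙-yes (yes _) _  = refl
𝟙-yes (no ¬P) pf = contradiction pf ¬P

𝟙-no : {P : Set p} (P? : Dec P) → ¬ P → 𝟙 P? ≡ 0
𝟙-no (yes pf) ¬P = contradiction pf ¬P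
𝟙-no (no _)   _  = refl

𝟙-mono : ∀ {p q} {P : Set p} {R : Set q} (P? : Dec P) (R? : Dec R) → (P → R) → 𝟙 P? ≤ 𝟙 R?
𝟙-mono (no _)   R? P⇒R = z≤n
𝟙-mono (yes pf) R? P⇒R = ≤-reflexive (sym (𝟙-yes R? (P⇒R pf)))

-- The second factor vanishes unless `R` holds, so the implication may assume `R`. This lets an
-- equation `s p ≡ x` be replaced by `s p ≡ s q` in the presence of `s q ≡ x`.
𝟙-*-mono : ∀ {p q r} {P : Set p} {S : Set q} {R : Set r} (P? : Dec P) (S? : Dec S) (R? : Dec R) →
           (P → R → S) → 𝟙 P? ℕ.* 𝟙 R? ≤ 𝟙 S? ℕ.* 𝟙 R?
𝟙-*-mono P? S? (yes r) P⇒R⇒S = *-monoˡ-≤ 1 (𝟙-mono P? S? (λ pf → P⇒R⇒S pf r))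
𝟙-*-mono P? S? (no _)  _     = ≤-reflexive (trans (*-zeroʳ (𝟙 P?)) (sym (*-zeroʳ (𝟙 S?))))

∑𝟙-none : {P : Pred X p} (P? : Decidable P) {xs : List X} → All (¬_ ∘ P) xs → ∑[ x ∈ xs ] 𝟙 (P? x) ≡ 0
∑𝟙-none P? []         = refl
∑𝟙-none P? (¬px ∷ ¬pxs) = cong₂ ℕ._+_ (𝟙-no (P? _) ¬px) (∑𝟙-none P? ¬pxs)

∑𝟙-unique-≤1 : {P : Pred X p} (P? : Decidable P) → (∀ {x y} → P x → P y → x ≡ y) →
               ∀ {xs} → Unique xs → ∑[ x ∈ xs ] 𝟙 (P? x) ≤ 1
∑𝟙-unique-≤1 P? P-prop {[]}     _         = z≤n
∑𝟙-unique-≤1 P? P-prop {x ∷ xs} (x∉ ∷ xs!) with P? x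
... | yes px = s≤s (≤-reflexive (∑𝟙-none P? (All.map (λ x≢y py → x≢y (P-prop px py)) x∉)))
... | no _   = ∑𝟙-unique-≤1 P? P-prop xs!

∑𝟙-∈-≥1 : {P : Pred X p} (P? : Decidable P) → ∀ {x xs} → x ∈ xs → P x → 1 ≤ ∑[ y ∈ xs ] 𝟙 (P? y)
∑𝟙-∈-≥1 P? {x} (here refl) px rewrite 𝟙-yes (P? x) px = s≤s z≤n
∑𝟙-∈-≥1 P? (there {y} x∈)  px = ≤-trans (∑𝟙-∈-≥1 P? x∈ px) (m≤n+m _ (𝟙 (P? y)))

-- Collisions of a map with bounded values.

collisions : (ps : List X) (s : X → ℕ) → ℕ
collisions ps s = ∑[ p ∈ ps ] ∑[ q ∈ ps ] 𝟙 (s p ≟ s q)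

-- Cauchy-Schwarz is applied to the fibre sizes `r x` over the `v` possible values. Every entry lies
-- in some fibre, so the sizes add up to at least `l`, and their squares count pairs within a common
-- fibre, which are collisions. For a sum map on a product of two sets, `collisions` is their
-- additive energy.
length²≤bound*collisions : (ps : List X) (s : X → ℕ) (v : ℕ) → (∀ p → s p ℕ.< v) →
                           ∀ {l} → l ≡ ∑[ p ∈ ps ] 1 → l ℕ.* l ≤ v ℕ.* collisions ps s
length²≤bound*collisions ps s v s<v {l} refl = begin
  l ℕ.* l                                     ≤⟨ *-mono-≤ l≤∑r l≤∑r ⟩
  ∑ V r ℕ.* ∑ V r                             ≤⟨ cauchy-schwarz V r ⟩
  length V ℕ.* (∑[ x ∈ V ] (r x ℕ.* r x))     ≡⟨ cong (ℕ._* (∑[ x ∈ V ] (r x ℕ.* r x))) (length-upTo v) ⟩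
  v ℕ.* (∑[ x ∈ V ] (r x ℕ.* r x))            ≤⟨ *-monoʳ-≤ v ∑r²≤ ⟩
  v ℕ.* collisions ps s                       ∎
  where
  open ≤-Reasoning
  V = upTo v
  r : ℕ → ℕ
  r x = ∑[ p ∈ ps ] 𝟙 (s p ≟ x)
  l≤∑r : l ≤ ∑ V r
  l≤∑r = ≤-trans (∑-mono ps (λ p → ∑𝟙-∈-≥1 (s p ≟_) (∈-upTo⁺ (s<v p)) refl)) (≤-reflexive (∑-swap ps V _))
  -- A value `x` shared by `s p` and `s q` forces them to be equal, and then there is at most one
  -- such `x`.
  inner : ∀ p q → ∑[ x ∈ V ] (𝟙 (s p ≟ x) ℕ.* 𝟙 (s q ≟ x)) ≤ 𝟙 (s p ≟ s q)
  inner p q = begin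
    ∑[ x ∈ V ] (𝟙 (s p ≟ x) ℕ.* 𝟙 (s q ≟ x))   ≤⟨ ∑-mono V (λ x → 𝟙-*-mono (s p ≟ x) (s p ≟ s q) (s q ≟ x) (λ sp≡x sq≡x → trans sp≡x (sym sq≡x))) ⟩
    ∑[ x ∈ V ] (𝟙 (s p ≟ s q) ℕ.* 𝟙 (s q ≟ x)) ≡⟨ *-∑ V (𝟙 (s p ≟ s q)) _ ⟨
    𝟙 (s p ≟ s q) ℕ.* (∑[ x ∈ V ] 𝟙 (s q ≟ x)) ≤⟨ *-monoʳ-≤ (𝟙 (s p ≟ s q)) (∑𝟙-unique-≤1 (s q ≟_) (λ { refl refl → refl }) (upTo⁺ v)) ⟩
    𝟙 (s p ≟ s q) ℕ.* 1                        ≡⟨ *-identityʳ _ ⟩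
    𝟙 (s p ≟ s q)                              ∎
  ∑r²≤ : ∑[ x ∈ V ] (r x ℕ.* r x) ≤ collisions ps s
  ∑r²≤ = begin
    ∑[ x ∈ V ] (r x ℕ.* r x)
      ≡⟨ ∑-cong V (λ x → ∑-*-∑ ps ps _ _) ⟩
    ∑[ x ∈ V ] ∑[ p ∈ ps ] ∑[ q ∈ ps ] (𝟙 (s p ≟ x) ℕ.* 𝟙 (s q ≟ x))
      ≡⟨ ∑-swap V ps _ ⟩
    ∑[ p ∈ ps ] ∑[ x ∈ V ] ∑[ q ∈ ps ] (𝟙 (s p ≟ x) ℕ.* 𝟙 (s q ≟ x))
      ≡⟨ ∑-cong ps (λ p → ∑-swap V ps _) ⟩
    ∑[ p ∈ ps ] ∑[ q ∈ ps ] ∑[ x ∈ V ] (𝟙 (s p ≟ x) ℕ.* 𝟙 (s q ≟ x))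
      ≤⟨ ∑-mono ps (λ p → ∑-mono ps (inner p)) ⟩
    collisions ps s ∎

-- Representations as differences within an interval.

-- The weight W for I = {0,...,u-1}, in closed form max(u - |z|, 0). Kept as a double count, it
-- compares term by term with collisions.
intervalReps : ℕ → ℤ.ℤ → ℕ
intervalReps u z = ∑[ i ∈ allFin u ] ∑[ j ∈ allFin u ] 𝟙 (z ℤ.≟ + toℕ j ℤ.- + toℕ i)

length-allFin : ∀ u → length (allFin u) ≡ u
length-allFin u = length-tabulate {n = u} id

-- Each `i` leaves at most one `j`, namely z + i.
intervalReps≤ : ∀ u z → intervalReps u z ≤ u
intervalReps≤ u z = begin
  intervalReps u z         ≤⟨ ∑-≤-const (allFin u) (λ i → ∑𝟙-unique-≤1 (λ j → z ℤ.≟ + toℕ j ℤ.- + toℕ i) (determined i) (allFin⁺ u)) ⟩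
  length (allFin u) ℕ.* 1  ≡⟨ *-identityʳ _ ⟩
  length (allFin u)        ≡⟨ length-allFin u ⟩
  u                        ∎
  where
  open ≤-Reasoning
  determined : ∀ i {j j′ : Fin u} → z ≡ + toℕ j ℤ.- + toℕ i → z ≡ + toℕ j′ ℤ.- + toℕ i → j ≡ j′
  determined i {j} {j′} e e′ = toℕ-injective (ℤₚ.+-injective
    (∙-cancelʳ (ℤ.- + toℕ i) (+ toℕ j) (+ toℕ j′) (trans (sym e) e′)))

-- Each of the u² pairs (i, j) has a single difference, which occurs at most once in `zs`.
∑intervalReps≤ : ∀ u {zs} → Unique zs → ∑[ z ∈ zs ] intervalReps u z ≤ u ℕ.* u
∑intervalReps≤ u {zs} zs! = begin
  ∑[ z ∈ zs ] intervalReps u z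
    ≡⟨ ∑-swap zs U _ ⟩
  ∑[ i ∈ U ] ∑[ z ∈ zs ] ∑[ j ∈ U ] 𝟙 (z ℤ.≟ + toℕ j ℤ.- + toℕ i)
    ≡⟨ ∑-cong U (λ i → ∑-swap zs U _) ⟩
  ∑[ i ∈ U ] ∑[ j ∈ U ] ∑[ z ∈ zs ] 𝟙 (z ℤ.≟ + toℕ j ℤ.- + toℕ i)
    ≤⟨ ∑-≤-const U (λ i → ∑-≤-const U (λ j → ∑𝟙-unique-≤1 (ℤ._≟ + toℕ j ℤ.- + toℕ i) (λ { refl refl → refl }) zs!)) ⟩
  length U ℕ.* (length U ℕ.* 1)
    ≡⟨ cong (length U ℕ.*_) (*-identityʳ _) ⟩
  length U ℕ.* length U
    ≡⟨ cong₂ ℕ._*_ (length-allFin u) (length-allFin u) ⟩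
  u ℕ.* u ∎
  where
  open ≤-Reasoning
  U = allFin u

-- Energy estimates for a fixed set.

length-members : ∀ {n} (A : Subset n) → length (members A) ≡ Sub.∣ A ∣
length-members []          = refl
length-members (false ∷ A) = trans (length-map _ (members A)) (length-members A)
length-members (true ∷ A)  = cong suc (trans (length-map _ (members A)) (length-members A))

a+i≡b+j⇒a-b≡j-i : ∀ a i b j → a ℕ.+ i ≡ b ℕ.+ j → + a ℤ.- + b ≡ + j ℤ.- + i
a+i≡b+j⇒a-b≡j-i a i b j eq = begin
  + a ℤ.- + b                                 ≡⟨ insert (+ a) (+ i) (+ b) ⟩
  -- `+ a ℤ.+ + i` computes to `+ (a ℕ.+ i)`, so the equation between naturals applies under `+_`.
  (+ a ℤ.+ + i) ℤ.- (+ b ℤ.+ + i)             ≡⟨ cong (λ t → t ℤ.- (+ b ℤ.+ + i)) (cong +_ eq) ⟩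
  (+ b ℤ.+ + j) ℤ.- (+ b ℤ.+ + i)             ≡⟨ drop (+ b) (+ j) (+ i) ⟩
  + j ℤ.- + i                                 ∎
  where
  open ≡-Reasoning
  insert : ∀ x y z → x ℤ.- z ≡ (x ℤ.+ y) ℤ.- (z ℤ.+ y)
  insert = ℤ-Solver.solve-∀
  drop : ∀ x y z → (x ℤ.+ y) ℤ.- (x ℤ.+ z) ≡ y ℤ.- z
  drop = ℤ-Solver.solve-∀

module _ {n : ℕ} (A : Subset n) (u : ℕ) where

  private
    U  = allFin u
    as = members A
    k  = Sub.∣ A ∣
    W  = intervalReps u
    δ : Fin n → Fin n → ℤ.ℤ
    δ a b = + toℕ a ℤ.- + toℕ b
    ∑∑W : ℕ
    ∑∑W = ∑[ a ∈ as ] ∑[ b ∈ as ] W (δ a b)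

  -- The ku pairs (a, i) have sums below n + u, so many of them collide. Each collision a + i = b +
  -- j gives a representation of a - b counted by `W`.
  energy-lower-bound : (k ℕ.* u) ℕ.* (k ℕ.* u) ≤ (n ℕ.+ u) ℕ.* ∑∑W
  energy-lower-bound = ≤-trans
    (length²≤bound*collisions ps s (n ℕ.+ u) (λ (a , i) → +-mono-< (toℕ<n a) (toℕ<n i)) ku≡)
    (*-monoʳ-≤ (n ℕ.+ u) collisions≤)
    where
    open ≤-Reasoning
    ps = concatMap (λ a → map (a ,_) U) as
    s : Fin n × Fin u → ℕ
    s (a , i) = toℕ a ℕ.+ toℕ i
    ku≡ : k ℕ.* u ≡ ∑[ p ∈ ps ] 1
    ku≡ = begin-equality
      k ℕ.* u                        ≡⟨ cong₂ ℕ._*_ (length-members A) (trans (*-identityʳ _) (length-allFin u)) ⟨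
      length as ℕ.* (length U ℕ.* 1) ≡⟨ ∑-const as (length U ℕ.* 1) ⟨
      ∑[ a ∈ as ] (length U ℕ.* 1)   ≡⟨ ∑-cong as (λ a → ∑-const U 1) ⟨
      ∑[ a ∈ as ] ∑[ i ∈ U ] 1       ≡⟨ ∑-concatMap-map _,_ as U (λ _ → 1) ⟨
      ∑[ p ∈ ps ] 1                  ∎
    collisions≤ : collisions ps s ≤ ∑∑W
    collisions≤ = begin
      collisions ps s
        ≡⟨ ∑-concatMap-map _,_ as U _ ⟩
      ∑[ a ∈ as ] ∑[ i ∈ U ] ∑[ q ∈ ps ] 𝟙 (s (a , i) ≟ s q)
        ≡⟨ ∑-cong as (λ a → ∑-cong U (λ i → ∑-concatMap-map _,_ as U _)) ⟩
      ∑[ a ∈ as ] ∑[ i ∈ U ] ∑[ b ∈ as ] ∑[ j ∈ U ] 𝟙 (s (a , i) ≟ s (b , j))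
        ≡⟨ ∑-cong as (λ a → ∑-swap U as _) ⟩
      ∑[ a ∈ as ] ∑[ b ∈ as ] ∑[ i ∈ U ] ∑[ j ∈ U ] 𝟙 (s (a , i) ≟ s (b , j))
        ≤⟨ ∑-mono as (λ a → ∑-mono as (λ b → ∑-mono U (λ i → ∑-mono U (λ j →
             𝟙-mono (s (a , i) ≟ s (b , j)) (δ a b ℤ.≟ + toℕ j ℤ.- + toℕ i)
               (a+i≡b+j⇒a-b≡j-i (toℕ a) (toℕ i) (toℕ b) (toℕ j)))))) ⟩
      ∑∑W ∎

  -- Deduplication can only decrease a sum of nonnegative terms; applied to u ∸ W, it turns
  -- the repetition of short differences into a saving.
  diffCard-energy : diffCard A ℕ.* u ℕ.+ ∑∑W ≤ u ℕ.* u ℕ.+ k ℕ.* (k ℕ.* u)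
  diffCard-energy = begin
    diffCard A ℕ.* u ℕ.+ ∑∑W
      ≡⟨ cong (ℕ._+ ∑∑W) (∑-const D u) ⟨
    (∑[ z ∈ D ] u) ℕ.+ ∑∑W
      -- Since W ≤ u, the truncated subtraction is exact.
      ≡⟨ cong (ℕ._+ ∑∑W) (∑-cong D (λ z → m+[n∸m]≡n (intervalReps≤ u z))) ⟨
    (∑[ z ∈ D ] (W z ℕ.+ (u ∸ W z))) ℕ.+ ∑∑W
      ≡⟨ cong (ℕ._+ ∑∑W) (∑-+ D W (λ z → u ∸ W z)) ⟩
    ∑ D W ℕ.+ (∑[ z ∈ D ] (u ∸ W z)) ℕ.+ ∑∑W
      -- The `W` part uses that the entries of `D` are distinct. The complementary part passes to
      -- the list `Δ` with repetitions, whose k² terms then recombine with `∑∑W` to `u` each.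
      ≤⟨ +-monoˡ-≤ ∑∑W (+-mono-≤ (∑intervalReps≤ u (deduplicate-! ℤ._≟_ Δ)) (∑-deduplicate-≤ ℤ._≟_ Δ _)) ⟩
    u ℕ.* u ℕ.+ (∑[ z ∈ Δ ] (u ∸ W z)) ℕ.+ ∑∑W
      ≡⟨ +-assoc (u ℕ.* u) _ ∑∑W ⟩
    u ℕ.* u ℕ.+ ((∑[ z ∈ Δ ] (u ∸ W z)) ℕ.+ ∑∑W)
      ≡⟨ cong (λ t → u ℕ.* u ℕ.+ (t ℕ.+ ∑∑W)) (∑-concatMap-map δ as as _) ⟩
    u ℕ.* u ℕ.+ ((∑[ a ∈ as ] ∑[ b ∈ as ] (u ∸ W (δ a b))) ℕ.+ ∑∑W)
      ≡⟨ cong (u ℕ.* u ℕ.+_) (∑-+ as _ _) ⟨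
    u ℕ.* u ℕ.+ (∑[ a ∈ as ] ((∑[ b ∈ as ] (u ∸ W (δ a b))) ℕ.+ (∑[ b ∈ as ] W (δ a b))))
      ≡⟨ cong (u ℕ.* u ℕ.+_) (∑-cong as (λ a → trans (sym (∑-+ as _ _))
           (∑-cong as (λ b → m∸n+n≡m (intervalReps≤ u (δ a b)))))) ⟩
    u ℕ.* u ℕ.+ (∑[ a ∈ as ] ∑[ b ∈ as ] u)
      ≡⟨ cong (u ℕ.* u ℕ.+_) (trans (∑-cong as (λ _ → ∑-const as u)) (∑-const as _)) ⟩
    u ℕ.* u ℕ.+ length as ℕ.* (length as ℕ.* u)
      ≡⟨ cong (λ t → u ℕ.* u ℕ.+ t ℕ.* (t ℕ.* u)) (length-members A) ⟩
    u ℕ.* u ℕ.+ k ℕ.* (k ℕ.* u) ∎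
    where
    open ≤-Reasoning
    Δ = concatMap (λ a → map (δ a) as) as
    D = diffSet A

  -- The two preceding estimates are combined to eliminate `∑∑W`, with (ku)² added to both sides in
  -- place of a subtraction. The summand n on the left contributes (n + u)nu, which completes (n +
  -- u)u² to (n + u)²u, and a common factor u > 0 cancels.
  diffCard-bound : .{{_ : NonZero u}} →
                   (n ℕ.+ u) ℕ.* (diffCard A ℕ.+ n) ≤ k ℕ.* k ℕ.* n ℕ.+ (n ℕ.+ u) ℕ.* (n ℕ.+ u)
  diffCard-bound = *-cancelʳ-≤ _ _ u (+-cancelʳ-≤ ((k ℕ.* u) ℕ.* (k ℕ.* u)) _ _ (begin
    (n ℕ.+ u) ℕ.* (diffCard A ℕ.+ n) ℕ.* u ℕ.+ (k ℕ.* u) ℕ.* (k ℕ.* u)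
      ≤⟨ +-monoʳ-≤ _ energy-lower-bound ⟩
    (n ℕ.+ u) ℕ.* (diffCard A ℕ.+ n) ℕ.* u ℕ.+ (n ℕ.+ u) ℕ.* ∑∑W
      ≡⟨ collect n u (diffCard A) ∑∑W ⟩
    (n ℕ.+ u) ℕ.* (diffCard A ℕ.* u ℕ.+ ∑∑W) ℕ.+ (n ℕ.+ u) ℕ.* n ℕ.* u
      ≤⟨ +-monoˡ-≤ _ (*-monoʳ-≤ (n ℕ.+ u) diffCard-energy) ⟩
    (n ℕ.+ u) ℕ.* (u ℕ.* u ℕ.+ k ℕ.* (k ℕ.* u)) ℕ.+ (n ℕ.+ u) ℕ.* n ℕ.* u
      ≡⟨ expand n u k ⟩
    (k ℕ.* k ℕ.* n ℕ.+ (n ℕ.+ u) ℕ.* (n ℕ.+ u)) ℕ.* u ℕ.+ (k ℕ.* u) ℕ.* (k ℕ.* u) ∎))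
    where
    open ≤-Reasoning
    collect : ∀ n u D w → (n ℕ.+ u) ℕ.* (D ℕ.+ n) ℕ.* u ℕ.+ (n ℕ.+ u) ℕ.* w
                        ≡ (n ℕ.+ u) ℕ.* (D ℕ.* u ℕ.+ w) ℕ.+ (n ℕ.+ u) ℕ.* n ℕ.* u
    collect = solve-∀
    expand : ∀ n u k → (n ℕ.+ u) ℕ.* (u ℕ.* u ℕ.+ k ℕ.* (k ℕ.* u)) ℕ.+ (n ℕ.+ u) ℕ.* n ℕ.* u
                     ≡ (k ℕ.* k ℕ.* n ℕ.+ (n ℕ.+ u) ℕ.* (n ℕ.+ u)) ℕ.* u ℕ.+ (k ℕ.* u) ℕ.* (k ℕ.* u)
    expand = solve-∀

-- Integer square roots and the choice of the interval length.

floor-sqrt : ∀ m → ∃ λ w → w ℕ.* w ≤ m × m ℕ.< suc w ℕ.* suc w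
floor-sqrt zero    = 0 , z≤n , s≤s z≤n
floor-sqrt (suc m) with floor-sqrt m
... | w , w²≤m , m<[1+w]² with suc m ℕ.<? suc w ℕ.* suc w
...   | yes 1+m< = w , ≤-trans w²≤m (n≤1+n m) , 1+m<
-- The root grows by exactly one: here (w + 1)² ≤ m + 1, while m < (w + 1)² gives m + 1 ≤ (w + 1)² <
-- (w + 2)².
...   | no  1+m≮ = suc w , ≮⇒≥ 1+m≮ , ≤-<-trans m<[1+w]² (*-mono-< (n<1+n (suc w)) (n<1+n (suc w)))

d≤ : ∀ k n B → (∀ (A : Subset n) → Sub.∣ A ∣ ≡ k → diffCard A ≤ B) → d k n ≤ B
-- The starting value 0 of the maximum satisfies the bound as well, which covers the case of no
-- admissible set.
d≤ k n B bound = foldr-preservesᵇ {P = _≤ B} ⊔-lub z≤n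
  (map⁺ (All.map (λ {A} → bound A) (all-filter (λ A → Sub.∣ A ∣ ≟ k) (allSubsets n))))

-- Here w = ⌊k√n⌋ and the interval has length u = w + 1 - n, making n + u the least integer above
-- k√n. The hypothesis says k√n ≥ n, so u is positive.
d-bound : ∀ n k → n ≤ k ℕ.* k →
          ∃ λ w → w ℕ.* w ≤ k ℕ.* k ℕ.* n × d k n ℕ.+ n ≤ suc (2 ℕ.* w)
d-bound n k n≤k² with floor-sqrt (k ℕ.* k ℕ.* n)
... | w , w²≤S , S<v² = w , w²≤S , (begin
    -- A maximum is bounded through its members alone, so `n` is moved to the right and back; n ≤ w
    -- keeps the subtraction exact.
    d k n ℕ.+ n                  ≤⟨ +-monoˡ-≤ n (d≤ k n (suc (2 ℕ.* w) ∸ n) (λ A ∣A∣≡k → m+n≤o⇒m≤o∸n (diffCard A) (per-set A ∣A∣≡k))) ⟩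
    (suc (2 ℕ.* w) ∸ n) ℕ.+ n    ≡⟨ m∸n+n≡m (≤-trans n≤w (≤-trans (m≤m+n w _) (n≤1+n _))) ⟩
    suc (2 ℕ.* w)                ∎)
  where
  open ≤-Reasoning
  v = suc w
  n<v : n ℕ.< v
  -- If v ≤ n, then v² ≤ n² ≤ k²n, against k²n < v².
  n<v = ≰⇒> λ v≤n → <⇒≱ S<v² (≤-trans (*-mono-≤ v≤n v≤n) (*-monoˡ-≤ n n≤k²))
  n≤w : n ≤ w
  n≤w = s≤s⁻¹ n<v
  u = v ∸ n
  n+u≡v : n ℕ.+ u ≡ v
  n+u≡v = m+[n∸m]≡n (<⇒≤ n<v)
  double : ∀ x → x ℕ.* x ℕ.+ x ℕ.* x ≡ x ℕ.* (2 ℕ.* x)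
  double = solve-∀
  per-set : ∀ (A : Subset n) → Sub.∣ A ∣ ≡ k → diffCard A ℕ.+ n ≤ suc (2 ℕ.* w)
  -- From v(|A-A| + n) ≤ k²n + v² < 2v² follows |A-A| + n < 2v = 2w + 2; strictness brings this down
  -- to 2w + 1.
  per-set A refl = s≤s⁻¹ (≤-trans (*-cancelˡ-< v _ _ (begin-strict
    v ℕ.* (diffCard A ℕ.+ n)           ≡⟨ cong (ℕ._* (diffCard A ℕ.+ n)) n+u≡v ⟨
    (n ℕ.+ u) ℕ.* (diffCard A ℕ.+ n)   ≤⟨ diffCard-bound A u {{>-nonZero (m<n⇒0<n∸m n<v)}} ⟩
    k ℕ.* k ℕ.* n ℕ.+ (n ℕ.+ u) ℕ.* (n ℕ.+ u) ≡⟨ cong (λ t → k ℕ.* k ℕ.* n ℕ.+ t ℕ.* t) n+u≡v ⟩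
    k ℕ.* k ℕ.* n ℕ.+ v ℕ.* v          <⟨ +-monoˡ-< (v ℕ.* v) S<v² ⟩
    v ℕ.* v ℕ.+ v ℕ.* v                ≡⟨ double v ⟩
    v ℕ.* (2 ℕ.* v)                    ∎)) (≤-reflexive (*-suc 2 w)))

-- Transfer to the rationals.

ι : ℕ → ℚ
ι m = + m Q./ 1

-- `Q./` normalises by a gcd, which does not compute for a variable `m`; arithmetic of `ι` is
-- therefore carried out on the unnormalised fraction m/1.
toℚᵘ-ι : ∀ m → Q.toℚᵘ (ι m) ℚᵘ.≃ mkℚᵘ (+ m) 0
toℚᵘ-ι m = Qₚ.toℚᵘ-fromℚᵘ (mkℚᵘ (+ m) 0)

ι-+ : ∀ m n → ι (m ℕ.+ n) ≡ ι m + ι n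
ι-+ m n = Qₚ.toℚᵘ-injective (begin
  Q.toℚᵘ (ι (m ℕ.+ n))                 ≈⟨ toℚᵘ-ι (m ℕ.+ n) ⟩
  mkℚᵘ (+ (m ℕ.+ n)) 0                 ≈⟨ *≡* (cong (ℤ._* + 1) (sym (cong₂ ℤ._+_ (ℤₚ.*-identityʳ (+ m)) (ℤₚ.*-identityʳ (+ n))))) ⟩
  mkℚᵘ (+ m) 0 ℚᵘ.+ mkℚᵘ (+ n) 0       ≈⟨ ℚᵘₚ.+-cong (toℚᵘ-ι m) (toℚᵘ-ι n) ⟨
  Q.toℚᵘ (ι m) ℚᵘ.+ Q.toℚᵘ (ι n)       ≈⟨ Qₚ.toℚᵘ-homo-+ (ι m) (ι n) ⟨
  Q.toℚᵘ (ι m + ι n)                   ∎)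
  where open import Relation.Binary.Reasoning.Setoid ℚᵘₚ.≃-setoid

ι-* : ∀ m n → ι (m ℕ.* n) ≡ ι m * ι n
ι-* m n = Qₚ.toℚᵘ-injective (begin
  Q.toℚᵘ (ι (m ℕ.* n))                 ≈⟨ toℚᵘ-ι (m ℕ.* n) ⟩
  mkℚᵘ (+ (m ℕ.* n)) 0                 ≈⟨ *≡* (cong (ℤ._* + 1) (ℤₚ.pos-* m n)) ⟩
  mkℚᵘ (+ m) 0 ℚᵘ.* mkℚᵘ (+ n) 0       ≈⟨ ℚᵘₚ.*-cong (toℚᵘ-ι m) (toℚᵘ-ι n) ⟨
  Q.toℚᵘ (ι m) ℚᵘ.* Q.toℚᵘ (ι n)       ≈⟨ Qₚ.toℚᵘ-homo-* (ι m) (ι n) ⟨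
  Q.toℚᵘ (ι m * ι n)                   ∎)
  where open import Relation.Binary.Reasoning.Setoid ℚᵘₚ.≃-setoid

ι-mono-≤ : ∀ {m n} → m ≤ n → ι m Q.≤ ι n
ι-mono-≤ {m} {n} m≤n = Qₚ.toℚᵘ-cancel-≤ (begin
  Q.toℚᵘ (ι m)   ≃⟨ toℚᵘ-ι m ⟩
  mkℚᵘ (+ m) 0   ≤⟨ *≤* (ℤₚ.*-monoʳ-≤-nonNeg (+ 1) (ℤ.+≤+ m≤n)) ⟩
  mkℚᵘ (+ n) 0   ≃⟨ toℚᵘ-ι n ⟨
  Q.toℚᵘ (ι n)   ∎)
  where open ℚᵘₚ.≤-Reasoning

-- With `q` + 1 the denominator of δ, δ ≥ 1/(q + 1), so n ≥ q + 2 gives δn > 1.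
1<δn : ∀ δ → Positive δ → ∃ λ N → ∀ n → N ≤ n → Q.1ℚ < δ * ι n
1<δn δ@(Q.mkℚ (+ suc m) q _) _ = 2 ℕ.+ q , λ n N≤n → Qₚ.toℚᵘ-cancel-< (begin-strict
  Q.toℚᵘ Q.1ℚ                        <⟨ *<* (subst₂ ℤ._<_ (ℤₚ.pos-* 1 (suc q)) (ℤₚ.pos-* (suc m ℕ.* n) 1) (ℤ.+<+ (1+q<[1+m]n n N≤n))) ⟩
  mkℚᵘ (+ (suc m ℕ.* n)) q           ≃⟨ *≡* (cong₂ ℤ._*_ (ℤₚ.pos-* (suc m) n) (cong (+_ ∘ suc) (*-identityʳ q))) ⟩
  Q.toℚᵘ δ ℚᵘ.* mkℚᵘ (+ n) 0         ≃⟨ ℚᵘₚ.*-cong (ℚᵘₚ.≃-refl {Q.toℚᵘ δ}) (toℚᵘ-ι n) ⟨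
  Q.toℚᵘ δ ℚᵘ.* Q.toℚᵘ (ι n)         ≃⟨ Qₚ.toℚᵘ-homo-* δ (ι n) ⟨
  Q.toℚᵘ (δ * ι n)                   ∎)
  where
  open ℚᵘₚ.≤-Reasoning
  1+q<[1+m]n : ∀ n → 2 ℕ.+ q ≤ n → 1 ℕ.* suc q ℕ.< suc m ℕ.* n ℕ.* 1
  1+q<[1+m]n n N≤n = ≤-trans (s≤s (≤-reflexive (*-identityˡ (suc q))))
    (≤-trans N≤n (≤-trans (m≤m+n n (m ℕ.* n)) (≤-reflexive (sym (*-identityʳ _)))))

-- D + n - 1 is a natural number at most 2w, so its square is at most 4w² ≤ 4Kn.
ι-bound : ∀ D n K w → 1 ≤ n → w ℕ.* w ≤ K ℕ.* n → D ℕ.+ n ≤ suc (2 ℕ.* w) →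
          (ι D + ι n - Q.1ℚ) * (ι D + ι n - Q.1ℚ) Q.≤ ι 4 * ι K * ι n
ι-bound D n K w 1≤n w²≤Kn D+n≤ = begin
  L * L                ≡⟨ cong₂ _*_ L≡ιM L≡ιM ⟩
  ι M * ι M            ≡⟨ ι-* M M ⟨
  ι (M ℕ.* M)          ≤⟨ ι-mono-≤ M²≤ ⟩
  ι (4 ℕ.* K ℕ.* n)    ≡⟨ trans (ι-* (4 ℕ.* K) n) (cong (_* ι n) (ι-* 4 K)) ⟩
  ι 4 * ι K * ι n      ∎
  where
  open Qₚ.≤-Reasoning
  L = ι D + ι n - Q.1ℚ
  -- As n ≥ 1, this agrees with the rational difference `L`.
  M = D ℕ.+ n ∸ 1
  L≡ιM : L ≡ ι M
  L≡ιM = begin-equality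
    ι D + ι n - Q.1ℚ      ≡⟨ cong (_- Q.1ℚ) (ι-+ D n) ⟨
    ι (D ℕ.+ n) - Q.1ℚ    ≡⟨ cong (λ t → ι t - Q.1ℚ) (m∸n+n≡m (≤-trans 1≤n (m≤n+m n D))) ⟨
    ι (M ℕ.+ 1) - Q.1ℚ    ≡⟨ cong (_- Q.1ℚ) (ι-+ M 1) ⟩
    ι M + Q.1ℚ - Q.1ℚ     ≡⟨ Qₚ.+-assoc (ι M) Q.1ℚ (Q.- Q.1ℚ) ⟩
    ι M + 0ℚ              ≡⟨ Qₚ.+-identityʳ (ι M) ⟩
    ι M                   ∎
  M≤2w : M ≤ 2 ℕ.* w
  M≤2w = ∸-monoˡ-≤ 1 D+n≤
  square : ∀ w → (2 ℕ.* w) ℕ.* (2 ℕ.* w) ≡ 4 ℕ.* (w ℕ.* w)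
  square = solve-∀
  M²≤ : M ℕ.* M ≤ 4 ℕ.* K ℕ.* n
  M²≤ = ≤-trans (*-mono-≤ M≤2w M≤2w) (≤-trans (≤-reflexive (square w))
    (≤-trans (*-monoʳ-≤ 4 w²≤Kn) (≤-reflexive (sym (*-assoc 4 K n)))))

-- The square root is avoided: for rational L, L ≤ 2k√n holds exactly when L ≤ 0 or L² ≤ 4k²n.
theorem8 : Σ (ℕ → ℚ) λ ε →
    ((δ : ℚ) → Positive δ → Σ ℕ λ N → (n : ℕ) → N ≤ n → ∣ ε n ∣ < δ * (+ n Q./ 1))
    × ((n k : ℕ) → 1 ≤ n → 1 ≤ k → n ≤ k ℕ.* k → k ≤ n →
    let L = (+ d k n Q./ 1) + (+ n Q./ 1) - ε n in
    (L Q.≤ 0ℚ) ⊎ (L * L Q.≤ (+ 4 Q./ 1) * (+ (k ℕ.* k) Q./ 1) * (+ n Q./ 1)))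
theorem8 = (λ _ → Q.1ℚ) , 1<δn , λ n k 1≤n _ n≤k² _ →
  let w , w²≤k²n , d+n≤ = d-bound n k n≤k²
  in inj₂ (ι-bound (d k n) n (k ℕ.* k) w 1≤n w²≤k²n d+n≤)
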